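{- Let $p$ be a prime and let $(X,S)$ be an association scheme such that $T:= \mathbf{O}_\theta(S) = \mathbf{O}^\theta(S) \cong C_p \times C_p$. Then the incidence structure $(\mathcal{P}, \mathcal{L})$ of $(X,S)$ is a partial linear space such that any point belongs to at most $p+1$ lines, and $\mathrm{Aut}(X/T,S/\!/T)$ is a subgroup of $\mathrm{Aut}(\mathcal{P}, \mathcal{L})$ (where $X/T$ is identified with $\mathcal{P}$ via $X_i\leftrightarrow i$).
   Context: An association scheme $(X,S)$ consists of a non-empty finite set $X$ and a partition $S$ of $X\times X$ such that: (i) $1_X:=\{(x,x)\mid x\in X\}\in S$; (ii) for each $s\in S$, $s^*:=\{(x,y)\mid (y,x)\in s\}\in S$; (iii) for all $s,t,u\in S$ the number $c_{st}^u:=|xs\cap yt^*|$ is constant whenever $(x,y)\in u$, where $xs:=\{y\in X\mid (x,y)\in s\}$. The valency of $s$ is $n_s:=c_{ss^*}^{1_X}$. For non-empty $P,Q\subseteq S$, the complex product $PQ$ is the set of all $s\in S$ with $c_{pq}^s\neq 0$ for some $p\in P$, $q\in Q$; singletons $\{s\}$ are written $s$. A non-empty $T\subseteq S$ is closed if $TT\subseteq T$, thin if moreover all its elements have valency 1 (then $T$ is a group under the relational product), and strongly normal if it is closed and $s^*Ts\subseteq T$ for all $s\in S$. The thin radical is $\mathbf{O}_\theta(S):=\{s\in S\mid n_s=1\}$; the thin residue $\mathbf{O}^\theta(S)$ is the intersection of all strongly normal closed subsets of $S$ (it is itself strongly normal). For $T$ closed, $xT:=\bigcup_{t\in T}xt$,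 $X/T:=\{xT\mid x\in X\}$ is the set of cosets, $s^T:=\{(xT,yT)\mid y\in xTsT\}$ and $S/\!/T:=\{s^T\mid s\in S\}$; $(X/T,S/\!/T)$ is the quotient scheme. For a scheme $(Y,R)$, $\mathrm{Aut}(Y,R)$ is the group of permutations $\phi$ of $Y$ such that $(x^\phi,y^\phi)\in r$ whenever $(x,y)\in r$, for every $r\in R$ (every relation is fixed). The incidence structure. Let $T:=\mathbf{O}^\theta(S)\cong C_p\times C_p$ and let $X_1,\dots,X_m$ be the cosets of $T$ in $X$. For $s\in S$ put $L(s):=\{t\in T\mid ts=s\}$; it satisfies $L(s)=L(s')$ for $s'\in TsT$. For $i,j\in\{1,\dots,m\}$ put $L_{ij}:=L(s)$ for any $s\in S$ with $s\cap(X_i\times X_j)\neq\varnothing$ (this is independent of the choice of $s$). For a subgroup $M$ with $\{1_X\}<M<T$ (strict inclusions) put $L_i(M):=\{i\}\cup\{j\mid L_{ij}=M\}$. Define $\mathcal{P}:=\{1,\dots,m\}$ (points) and $\mathcal{L}:=\{L_i(M)\mid \{1_X\}<M<T,\ |L_i(M)|\neq 1,\ 1\le i\le m\}$ (lines). A partial linear space is a pair $(\mathcal{P},\mathcal{L})$ of a set $\mathcal{P}$ of points and a family $\mathcal{L}$ of subsets of $\mathcal{P}$ (lines) such that every pair of distinct points is contained in at most one line and every line contains at least two points ($\mathcal{L}$ may be empty). $\mathrm{Aut}(\mathcal{P},\mathcal{L})$ is the group of permutations $\tau$ of $\mathcal{P}$ with $\mathcal{L}^\tau=\mathcal{L}$.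 -}

module Defs where

open import Data.Bool.Properties using () renaming (_≟_ to _≟ᵇ_)
open import Data.Fin using (Fin; toℕ)
open import Data.Fin.Permutation using (Permutation′; _⟨$⟩ʳ_; _⟨$⟩ˡ_; _∘ₚ_; flip)
  renaming (id to idₚ)
open import Data.Fin.Properties using (any?; nonZeroIndex) renaming (_≟_ to _≟ᶠ_)
open import Data.Fin.Subset
  using (Subset; ⁅_⁆; _∈_; _⊆_; _⊂_; _∩_; _∪_; ∣_∣; Nonempty)
open import Data.Fin.Subset.Properties using (_∈?_)
open import Data.List using (List; length)
open import Data.List.Relation.Unary.All using (All)
open import Data.List.Relation.Unary.Unique.Propositional using (Unique)
open import Data.Nat using (ℕ; _+_; _≤_; NonZero) renaming (_≟_ to _≟ⁿ_)
open import Data.Nat.DivMod using (_mod_)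
open import Data.Product using (∃; ∃₂; _×_; _,_; proj₁)
open import Data.Vec using (tabulate; lookup)
open import Data.Vec.Properties using (≡-dec)
open import Function using (_∘_) renaming (_⇔_ to _iff_)
open import Function.Definitions using (Injective)
open import Level using (0ℓ)
open import Relation.Binary.Construct.Composition using (_;_)
open import Relation.Binary.Core using (Rel; _⇔_; _=[_]⇒_)
open import Relation.Binary.Definitions using (DecidableEquality)
open import Relation.Binary.PropositionalEquality using (_≡_; _≢_)
open import Relation.Nullary.Decidable using (does; ¬?; _×-dec_)
open import Relation.Unary as U using (Pred; Decidable; _≐_)

------------------------------------------------------------------------
-- Finite sets

⟦_⟧ : ∀ {k} {P : Pred (Fin k) 0ℓ} → Decidable P → Subset k
⟦ P? ⟧ = tabulate (does ∘ P?)

_≟ˢ_ : ∀ {k} → DecidableEquality (Subset k)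
_≟ˢ_ = ≡-dec _≟ᵇ_

AtMost : ∀ {A : Set} → ℕ → Pred A 0ℓ → Set
AtMost k P = ∀ xs → Unique xs → All P xs → length xs ≤ k

------------------------------------------------------------------------
-- Association schemes

-- The partition S of X × X is given by its colour map: X is Fin n, the
-- elements of S are indexed by Fin d, and the relation with index s is
-- { (x , y) ∣ r x y ≡ s }.  The fields 1X, _* and c are determined by r,
-- as every s is non-empty.

record AssociationScheme : Set where
  field
    n d         : ℕ
    {{n-nonZero}} : NonZero n
    r           : Fin n → Fin n → Fin d
    r-nonempty  : ∀ s → ∃₂ λ x y → r x y ≡ s

  infix 10 _⟶_

  _⟶_ : Fin n → Fin d → Subset n
  x ⟶ s = ⟦ (λ y → r x y ≟ᶠ s) ⟧

  field
    1X          : Fin d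
    1X-diagonal : ∀ x y → (r x y ≡ 1X) iff (x ≡ y)
    _*          : Fin d → Fin d
    *-converse  : ∀ s x y → (r x y ≡ s *) iff (r y x ≡ s)
    c           : Fin d → Fin d → Fin d → ℕ
    c-regular   : ∀ s t u x y → r x y ≡ u → ∣ (x ⟶ s) ∩ (y ⟶ (t *)) ∣ ≡ c s t u

  rel : Fin d → Rel (Fin n) 0ℓ
  rel s x y = r x y ≡ s

  valency : Fin d → ℕ
  valency s = c s (s *) 1X

  infixl 7 _·_

  _·_ : Subset d → Subset d → Subset d
  P · Q = ⟦ (λ s → any? λ p → any? λ q →
               (p ∈? P) ×-dec (q ∈? Q) ×-dec ¬? (c p q s ≟ⁿ 0)) ⟧

  -- The union of the sets x ⟶ s over s ∈ P.
  infix 5 _⟶⋃_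

  _⟶⋃_ : Fin n → Subset d → Subset n
  x ⟶⋃ P = ⟦ (λ y → any? λ s → (s ∈? P) ×-dec (y ∈? (x ⟶ s))) ⟧

  record IsClosed (T : Subset d) : Set where
    field
      nonempty : Nonempty T
      closed   : T · T ⊆ T

  record IsStronglyNormal (T : Subset d) : Set where
    field
      isClosed : IsClosed T
      normal   : ∀ s → ⁅ s * ⁆ · T · ⁅ s ⁆ ⊆ T

  thinRadical : Subset d
  thinRadical = ⟦ (λ s → valency s ≟ⁿ 1) ⟧

  thinResidue : Pred (Fin d) 0ℓ
  thinResidue s = ∀ U → IsStronglyNormal U → s ∈ U

------------------------------------------------------------------------
-- Thin closed subsets as groups under the relational product

-- Addition modulo p; the inhabitant a shows that p is non-zero.
infixl 6 _⊕_

_⊕_ : ∀ {p} → Fin p → Fin p → Fin p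
_⊕_ {p} a b = _mod_ (toℕ a + toℕ b) p {{nonZeroIndex a}}

module _ (S : AssociationScheme) where
  open AssociationScheme S

  -- A group isomorphism from C_p × C_p onto T.
  record IsomorphicToCp×Cp (p : ℕ) (T : Subset d) : Set where
    field
      φ          : Fin p × Fin p → Fin d
      injective  : Injective _≡_ _≡_ φ
      image      : (_∈ T) ≐ (λ s → ∃ λ a → φ a ≡ s)
      homo       : ∀ a₁ a₂ b₁ b₂ →
                   rel (φ (a₁ ⊕ b₁ , a₂ ⊕ b₂)) ⇔ (rel (φ (a₁ , a₂)) ; rel (φ (b₁ , b₂)))

  -- Meaningful when T is thin: the inverse of s is then s *.
  record IsSubgroup (M T : Subset d) : Set where
    field
      ⊆T        : M ⊆ T
      1X∈       : 1X ∈ M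
      ;-closed  : ∀ {s t u} → s ∈ M → t ∈ M → rel u ⇔ (rel s ; rel t) → u ∈ M
      *-closed  : ∀ {s} → s ∈ M → s * ∈ M

------------------------------------------------------------------------
-- Cosets and the quotient scheme

  record CosetEnumeration (T : Subset d) (m : ℕ) : Set where
    field
      X         : Fin m → Subset n
      injective : Injective _≡_ _≡_ X
      isCoset   : ∀ i → ∃ λ x → X i ≡ (x ⟶⋃ T)
      covers    : ∀ x → ∃ λ i → X i ≡ (x ⟶⋃ T)

    rep : Fin m → Fin n
    rep = proj₁ ∘ isCoset

    -- The relation s^T, with the coset X i identified with i.
    quotient : Fin d → Rel (Fin m) 0ℓ
    quotient s i j = ∃₂ λ x y →
      X i ≡ (x ⟶⋃ T) × X j ≡ (y ⟶⋃ T) × y ∈ (x ⟶⋃ T · ⁅ s ⁆ · T)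

------------------------------------------------------------------------
-- The incidence structure

  module _ (T : Subset d) where

    L : Fin d → Subset d
    L s = ⟦ (λ t → (t ∈? T) ×-dec ((⁅ t ⁆ · ⁅ s ⁆) ≟ˢ ⁅ s ⁆)) ⟧

    module _ {m : ℕ} (E : CosetEnumeration T m) where
      open CosetEnumeration E

      -- L s depends only on i and j among the s meeting X i × X j when
      -- T is both the thin radical and the thin residue and is abelian;
      -- the s used here is the relation containing the pair of
      -- (arbitrary) coset representatives supplied by E.
      Lᵢⱼ : Fin m → Fin m → Subset d
      Lᵢⱼ i j = L (r (rep i) (rep j))

      lineAt : Fin m → Subset d → Subset m
      lineAt i M = ⁅ i ⁆ ∪ ⟦ (λ j → Lᵢⱼ i j ≟ˢ M) ⟧

      IsLine : Pred (Subset m) 0ℓ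
      IsLine ℓ = ∃₂ λ i M →
        IsSubgroup M T × ⁅ 1X ⁆ ⊂ M × M ⊂ T ×
        ∣ lineAt i M ∣ ≢ 1 × ℓ ≡ lineAt i M

------------------------------------------------------------------------
-- Partial linear spaces and automorphism groups

record IsPartialLinearSpace {m : ℕ} (𝓛 : Pred (Subset m) 0ℓ) : Set where
  field
    unique-line : ∀ {i j ℓ ℓ′} → i ≢ j → 𝓛 ℓ → 𝓛 ℓ′ →
                  i ∈ ℓ → j ∈ ℓ → i ∈ ℓ′ → j ∈ ℓ′ → ℓ ≡ ℓ′
    two-points  : ∀ {ℓ} → 𝓛 ℓ → 2 ≤ ∣ ℓ ∣

image : ∀ {m} → Permutation′ m → Subset m → Subset m
image τ ℓ = tabulate (λ i → lookup ℓ (τ ⟨$⟩ˡ i))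

IncidenceAut : ∀ {m} → Pred (Subset m) 0ℓ → Pred (Permutation′ m) 0ℓ
IncidenceAut 𝓛 τ = (λ ℓ → ∃ λ ℓ′ → 𝓛 ℓ′ × image τ ℓ′ ≡ ℓ) ≐ 𝓛

SchemeAut : ∀ {m} {I : Set} → (I → Rel (Fin m) 0ℓ) → Pred (Permutation′ m) 0ℓ
SchemeAut R φ = ∀ k → R k =[ φ ⟨$⟩ʳ_ ]⇒ R k

record _IsSubgroupOf_ {m : ℕ} (K H : Pred (Permutation′ m) 0ℓ) : Set where
  field
    included  : K U.⊆ H
    id∈       : K idₚ
    ∘-closed  : ∀ {φ ψ} → K φ → K ψ → K (φ ∘ₚ ψ)
    ⁻¹-closed : ∀ {φ} → K φ → K (flip φ)

{-# OPTIONS --safe #-}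

-- The subgroup L(s) equals s s*: if r x′ y = r x y = s, then the element of T
-- joining x′ to x lies in L(s), and conversely.  Since T is abelian and
-- strongly normal, L(r x y) depends only on the cosets of x and y.  If
-- L(r x y) = L(r x z) has order p and y, z lie in different cosets, then
-- L(r y z) = L(r y x); hence the line L_i(L_ij) is also L_j(L_ji), and a line
-- is determined by any two of its points.  The lines through i correspond to
-- distinct subgroups of order p of C_p × C_p, and such a subgroup is determined
-- by the one it contains of the p + 1 elements (1 , b) and (0 , 1).
-- Automorphisms of the quotient scheme preserve (i , j) ↦ L_ij, hence the lines.

module Submission where

open import Defs
open import Data.Bool using (true)
open import Data.Fin using (Fin; toℕ; splitAt; join)
open import Data.Fin.Permutation using (Permutation′; _⟨$⟩ʳ_; _⟨$⟩ˡ_; inverseˡ; inverseʳ; flip)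
open import Data.Fin.Properties
  using (toℕ-injective; toℕ-fromℕ<; toℕ<n; any?; splitAt-join; injective⇒≤)
  renaming (_≟_ to _≟ᶠ_)
open import Data.Fin.Subset using (Subset; _∈_; _⊆_; _∩_; ∣_∣; ⁅_⁆)
open import Data.Fin.Subset.Properties
  using (_∈?_; nonempty?; Empty-unique; ∣⊥∣≡0; x∈⁅x⁆; x∈⁅y⁆⇒x≡y; ∣⁅x⁆∣≡1; ⊆-antisym;
         x∈p∩q⁺; x∈p∩q⁻; x∈p∪q⁺; x∈p∪q⁻; x∈p∧x≢y⇒x∈p-y; x∈p⇒∣p-x∣<∣p∣)
open import Data.List using (List; lookup)
open import Data.List.Membership.Propositional.Properties using (∈-lookup)
open import Data.List.Relation.Unary.All as All using ()
open import Data.List.Relation.Unary.AllPairs using (_∷_)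
open import Data.List.Relation.Unary.Unique.Propositional using (Unique)
open import Data.Nat using (ℕ; suc; pred; _+_; _*_; _≤_; _<_; s≤s; z≤n; NonZero; >-nonZero)
  renaming (_≟_ to _≟ⁿ_)
open import Data.Nat.Coprimality using (prime⇒coprime; coprime-Bézout)
open import Data.Nat.DivMod
  using (_mod_; _%_; m<n⇒m%n≡m; %-distribˡ-+; [m+kn]%n≡m%n; m%n<n)
open import Data.Nat.GCD using (module Bézout)
open import Data.Nat.Primality using (Prime; prime⇒nonZero)
open import Data.Nat.Properties
  using (suc-pred; +-comm; *-comm; *-identityʳ; n≢0⇒n>0; ≤-trans; ≤-reflexive; n≮0; <-irrefl)
open import Data.Nat.Tactic.RingSolver using (solve-∀)
open import Data.Product using (∃; ∃₂; _×_; _,_; proj₁; proj₂)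
open import Data.Sum using (_⊎_; inj₁; inj₂)
open import Data.Vec as Vec using ()
open import Data.Vec.Properties
  using (lookup∘tabulate; []=⇒lookup; lookup⇒[]=; tabulate-cong; tabulate∘lookup)
open import Function using (_∘_; Equivalence)
open import Level using (0ℓ)
open import Relation.Binary.PropositionalEquality
  using (_≡_; _≢_; refl; sym; trans; cong; cong₂; subst; subst₂; module ≡-Reasoning)
open import Relation.Nullary using (¬_; Dec; yes; no; contradiction)
open import Relation.Nullary.Decidable using (does; dec-true; ¬?; _×-dec_; decidable-stable)
open import Relation.Unary using (Pred; Decidable; _≐_) renaming (_⊆_ to _⊆ᵖ_)

-- Bounding the length of duplicate-free lists

lookup-injective : ∀ {A : Set} {xs : List A} → Unique xs →
                   ∀ {i j} → lookup xs i ≡ lookup xs j → i ≡ j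
lookup-injective (_ ∷ _) {Fin.zero} {Fin.zero} _ = refl
lookup-injective (x∉xs ∷ _) {Fin.zero} {Fin.suc j} eq =
  contradiction eq (All.lookup x∉xs (∈-lookup j))
lookup-injective (x∉xs ∷ _) {Fin.suc i} {Fin.zero} eq =
  contradiction (sym eq) (All.lookup x∉xs (∈-lookup i))
lookup-injective (_ ∷ u) {Fin.suc i} {Fin.suc j} eq = cong Fin.suc (lookup-injective u eq)

-- Choosing a label for each entry gives an injection from the positions of the list into `Fin k`.
-- `Label` is a relation, so an element may carry several labels.
atMost-by-labels : ∀ {A : Set} {P : Pred A 0ℓ} {k} (Label : A → Fin k → Set) →
                   (∀ {x} → P x → ∃ (Label x)) →
                   (∀ {x y c} → P x → P y → Label x c → Label y c → x ≡ y) →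
                   AtMost k P
atMost-by-labels Label label label-injective xs unique all =
  injective⇒≤ {f = λ i → proj₁ (label (P-at i))} λ {i} {j} eq →
    lookup-injective unique
      (label-injective (P-at i) (P-at j) (proj₂ (label (P-at i)))
        (subst (Label _) (sym eq) (proj₂ (label (P-at j)))))
  where
  P-at = λ i → All.lookup all (∈-lookup i)

-- Subgroups of C_p × C_p

module Plane {p : ℕ} (p-prime : Prime p) where

  instance
    p-nonZero : NonZero p
    p-nonZero = prime⇒nonZero p-prime

  opaque

    [_] : ℕ → Fin p
    [ k ] = k mod p

    toℕ-[] : ∀ k → toℕ [ k ] ≡ k % p
    toℕ-[] k = toℕ-fromℕ< (m%n<n k p)

    ⊕≡[+] : ∀ a b → a ⊕ b ≡ [ toℕ a + toℕ b ]
    ⊕≡[+] a b = refl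

  []-cong : ∀ {k l} → k % p ≡ l % p → [ k ] ≡ [ l ]
  []-cong {k} {l} eq = toℕ-injective (trans (toℕ-[] k) (trans eq (sym (toℕ-[] l))))

  []-toℕ : ∀ a → [ toℕ a ] ≡ a
  []-toℕ a = toℕ-injective (trans (toℕ-[] (toℕ a)) (m<n⇒m%n≡m (toℕ<n a)))

  []-⊕ : ∀ k l → [ k ] ⊕ [ l ] ≡ [ k + l ]
  []-⊕ k l = trans (⊕≡[+] [ k ] [ l ])
    ([]-cong (trans (cong₂ (λ a b → (a + b) % p) (toℕ-[] k) (toℕ-[] l))
                    (sym (%-distribˡ-+ k l p))))

  []-+* : ∀ k l → [ k + l * p ] ≡ [ k ]
  []-+* k l = []-cong ([m+kn]%n≡m%n k l p)

  ⊕-comm : ∀ (a b : Fin p) → a ⊕ b ≡ b ⊕ a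
  ⊕-comm a b = trans (⊕≡[+] a b)
    (trans (cong [_] (+-comm (toℕ a) (toℕ b))) (sym (⊕≡[+] b a)))

  -- Modulo p, `pred p * l` serves as -l, so that negation stays within the natural numbers.
  []-cancel : ∀ k l → [ k + (l + pred p * l) ] ≡ [ k ]
  []-cancel k l =
    trans (cong (λ n → [ k + n ]) (trans (cong (_* l) (suc-pred p)) (*-comm p l))) ([]-+* k l)

  ⊕-inverse : ∀ a → ∃ λ b → a ⊕ b ≡ [ 0 ]
  ⊕-inverse a = [ pred p * toℕ a ] ,
    trans (cong (_⊕ [ pred p * toℕ a ]) (sym ([]-toℕ a)))
      (trans ([]-⊕ (toℕ a) _) ([]-cancel 0 (toℕ a)))

  -- If v x ≡ −1, then the inverse of x is v x v; the identity
  -- w² + 2 (1 + w) = (1 + w)² + 1 with w = v x avoids subtraction.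
  invertible : ∀ a → a ≢ [ 0 ] → ∃ λ k → [ k * toℕ a ] ≡ [ 1 ]
  invertible a a≢0
    with a-nonZero ← >-nonZero (n≢0⇒n>0 λ eq → a≢0 (trans (sym ([]-toℕ a)) (cong [_] eq)))
    with coprime-Bézout (prime⇒coprime p-prime {{a-nonZero}} (toℕ<n a))
  ... | Bézout.-+ u v eq = v , trans (cong [_] (sym eq)) ([]-+* 1 u)
  ... | Bézout.+- u v eq = v * x * v , (begin
    [ v * x * v * x ]                 ≡⟨ []-+* _ (2 * u) ⟨
    [ v * x * v * x + 2 * u * p ]     ≡⟨ cong [_] (rearrange v x u p) ⟩
    [ v * x * v * x + 2 * (u * p) ]   ≡⟨ cong (λ n → [ v * x * v * x + 2 * n ]) eq ⟨
    [ v * x * v * x + 2 * (1 + v * x) ] ≡⟨ cong [_] (square v x) ⟩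
    [ 1 + (1 + v * x) * (1 + v * x) ] ≡⟨ cong (λ n → [ 1 + (1 + v * x) * n ]) eq ⟩
    [ 1 + (1 + v * x) * (u * p) ]     ≡⟨ cong [_] (reassoc (1 + v * x) u p) ⟩
    [ 1 + (1 + v * x) * u * p ]       ≡⟨ []-+* 1 ((1 + v * x) * u) ⟩
    [ 1 ] ∎)
    where
    open ≡-Reasoning
    x = toℕ a
    rearrange : ∀ v x u p → v * x * v * x + 2 * u * p ≡ v * x * v * x + 2 * (u * p)
    rearrange = solve-∀
    square : ∀ v x → v * x * v * x + 2 * (1 + v * x) ≡ 1 + (1 + v * x) * (1 + v * x)
    square = solve-∀
    reassoc : ∀ w u p → 1 + w * (u * p) ≡ 1 + w * u * p
    reassoc = solve-∀

  origin : Fin p × Fin p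
  origin = [ 0 ] , [ 0 ]

  -- Representatives of the p + 1 points of the projective line over the field with p elements.
  direction : Fin p ⊎ Fin 1 → Fin p × Fin p
  direction (inj₁ b) = [ 1 ] , b
  direction (inj₂ _) = [ 0 ] , [ 1 ]

  -- In a finite group a submonoid is a subgroup: here -a is the multiple `pred p` of a.
  record IsSubmonoid (A : Pred (Fin p × Fin p) 0ℓ) : Set where
    field
      origin∈  : A origin
      ⊕-closed : ∀ {a₁ a₂ b₁ b₂} → A (a₁ , a₂) → A (b₁ , b₂) → A (a₁ ⊕ b₁ , a₂ ⊕ b₂)

    +-closed : ∀ {x y u v} → A ([ x ] , [ y ]) → A ([ u ] , [ v ]) → A ([ x + u ] , [ y + v ])
    +-closed {x} {y} {u} {v} h k =
      subst A (cong₂ _,_ ([]-⊕ x u) ([]-⊕ y v)) (⊕-closed h k)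

    scale : ∀ k {x y} → A ([ x ] , [ y ]) → A ([ k * x ] , [ k * y ])
    scale 0       h = origin∈
    scale (suc k) h = +-closed h (scale k h)

    ∈-toℕ : ∀ {a b} → A (a , b) → A ([ toℕ a ] , [ toℕ b ])
    ∈-toℕ {a} {b} = subst A (sym (cong₂ _,_ ([]-toℕ a) ([]-toℕ b)))

    vertical∈ : ∀ {b} → b ≢ [ 0 ] → A ([ 0 ] , b) → A ([ 0 ] , [ 1 ])
    vertical∈ {b} b≢0 h with k , eq ← invertible b b≢0 =
      subst A (cong₂ _,_ (cong [_] (*-comm k 0)) eq)
        (scale k (subst (λ c → A ([ 0 ] , c)) (sym ([]-toℕ b)) h))

    slanted∈ : ∀ {a b} → a ≢ [ 0 ] → A (a , b) → ∃ λ c → A ([ 1 ] , c)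
    slanted∈ {a} {b} a≢0 h with k , eq ← invertible a a≢0 =
      [ k * toℕ b ] , subst (λ c → A (c , [ k * toℕ b ])) eq (scale k (∈-toℕ h))

    -- Multiply by the inverse of the first nonzero coordinate.
    direction∈ : ∀ {a} → a ≢ origin → A a → ∃ λ d → A (direction d)
    direction∈ {a , b} a≢0 h with a ≟ᶠ [ 0 ]
    ... | no a≢0′ with c , h′ ← slanted∈ a≢0′ h = inj₁ c , h′
    ... | yes refl = inj₂ Fin.zero , vertical∈ (λ { refl → a≢0 refl }) h

    -- (a , b) = a (1 , c) + (b - ac) (0 , 1); `k` below stands for b - ac.
    spanned : ∀ {c} → A ([ 1 ] , c) → A ([ 0 ] , [ 1 ]) → ∀ a → A a
    spanned {c} h v (a , b) =
      subst A (cong₂ _,_ (trans (cong [_] (first x k)) ([]-toℕ a))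
                         (trans (cong [_] (second x y z (pred p)))
                                (trans ([]-cancel y (x * z)) ([]-toℕ b))))
        (+-closed (scale x (subst (λ e → A ([ 1 ] , e)) (sym ([]-toℕ c)) h)) (scale k v))
      where
      x = toℕ a
      y = toℕ b
      z = toℕ c
      k = y + pred p * (x * z)
      first : ∀ x k → x * 1 + k * 0 ≡ x
      first = solve-∀
      second : ∀ x y z q → x * z + (y + q * (x * z)) * 1 ≡ y + (x * z + q * (x * z))
      second = solve-∀

    -- Subtracting a (1 , c) from (a , b) leaves (0 , b - ac). If b - ac were nonzero, scaling would
    -- put (0 , 1) into `A`, and `A` would be everything.
    on-slanted : ∀ {a b c} → ¬ (∀ a → A a) → A ([ 1 ] , c) → A (a , b) →
                 [ toℕ a * toℕ c ] ≡ b
    on-slanted {a} {b} {c} proper h k with [ toℕ b + pred p * toℕ a * toℕ c ] ≟ᶠ [ 0 ]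
    ... | no ≢0 = contradiction (spanned h (vertical∈ ≢0
        (subst (λ e → A (e , [ toℕ b + pred p * x * toℕ c ])) zero-first
          (+-closed (∈-toℕ k)
            (scale (pred p * x) (subst (λ e → A ([ 1 ] , e)) (sym ([]-toℕ c)) h)))))) proper
      where
      x = toℕ a
      rearrange : ∀ x q → x + q * x * 1 ≡ 0 + (x + q * x)
      rearrange = solve-∀
      zero-first : [ x + pred p * x * 1 ] ≡ [ 0 ]
      zero-first = trans (cong [_] (rearrange x (pred p))) ([]-cancel 0 x)
    ... | yes ≡0 = begin
      [ x * z ]                              ≡⟨ []-⊕ 0 (x * z) ⟨
      [ 0 ] ⊕ [ x * z ]                      ≡⟨ cong (_⊕ [ x * z ]) ≡0 ⟨
      [ y + pred p * x * z ] ⊕ [ x * z ]     ≡⟨ []-⊕ _ (x * z) ⟩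
      [ y + pred p * x * z + x * z ]         ≡⟨ cong [_] (rearrange x y z (pred p)) ⟩
      [ y + (x * z + pred p * (x * z)) ]     ≡⟨ []-cancel y (x * z) ⟩
      [ y ]                                  ≡⟨ []-toℕ b ⟩
      b ∎
      where
      open ≡-Reasoning
      x = toℕ a
      y = toℕ b
      z = toℕ c
      rearrange : ∀ x y z q → y + q * x * z + x * z ≡ y + (x * z + q * (x * z))
      rearrange = solve-∀

    on-vertical : ∀ {a b} → ¬ (∀ a → A a) → A ([ 0 ] , [ 1 ]) → A (a , b) → a ≡ [ 0 ]
    on-vertical {a} proper v h with a ≟ᶠ [ 0 ]
    ... | yes a≡0 = a≡0
    ... | no a≢0 = contradiction (spanned (proj₂ (slanted∈ a≢0 h)) v) proper

  -- A proper subgroup containing a direction consists of the multiples of that direction, and `B`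
  -- contains all of these.
  determined-by-direction :
    ∀ {A B} → IsSubmonoid A → IsSubmonoid B → ¬ (∀ a → A a) →
    ∀ d → A (direction d) → B (direction d) → A ⊆ᵖ B
  determined-by-direction {A} {B} A-sub B-sub proper (inj₁ c) h k {a , b} ab =
    subst B (cong₂ _,_ (trans (cong [_] (*-identityʳ (toℕ a))) ([]-toℕ a))
                       (S.on-slanted proper h ab))
      (R.scale (toℕ a) (subst (λ e → B ([ 1 ] , e)) (sym ([]-toℕ c)) k))
    where
    module S = IsSubmonoid A-sub
    module R = IsSubmonoid B-sub
  determined-by-direction {A} {B} A-sub B-sub proper (inj₂ _) h k {a , b} ab =
    subst B (cong₂ _,_ (trans (cong [_] (*-comm (toℕ b) 0)) (sym (S.on-vertical proper h ab)))
                       (trans (cong [_] (*-identityʳ (toℕ b))) ([]-toℕ b)))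
      (R.scale (toℕ b) k)
    where
    module S = IsSubmonoid A-sub
    module R = IsSubmonoid B-sub

-- Finite subsets and their images under permutations

does-true⁻ : ∀ {A : Set} (a? : Dec A) → does a? ≡ true → A
does-true⁻ (yes a) _ = a

module _ {k} {P : Pred (Fin k) 0ℓ} (P? : Decidable P) where

  ∈⟦⟧⁺ : ∀ {x} → P x → x ∈ ⟦ P? ⟧
  ∈⟦⟧⁺ {x} px = lookup⇒[]= x _ (trans (lookup∘tabulate _ x) (dec-true (P? x) px))

  ∈⟦⟧⁻ : ∀ {x} → x ∈ ⟦ P? ⟧ → P x
  ∈⟦⟧⁻ {x} x∈ = does-true⁻ (P? x) (trans (sym (lookup∘tabulate _ x)) ([]=⇒lookup x∈))

module _ {k} {A : Subset k} where

  ∈⇒0<∣∣ : ∀ {x} → x ∈ A → 0 < ∣ A ∣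
  ∈⇒0<∣∣ x∈A = ≤-trans (s≤s z≤n) (x∈p⇒∣p-x∣<∣p∣ x∈A)

  ∣∣≢0⇒∃∈ : ∣ A ∣ ≢ 0 → ∃ (_∈ A)
  ∣∣≢0⇒∃∈ ≢0 with nonempty? A
  ... | yes x∈A = x∈A
  ... | no empty = contradiction (trans (cong ∣_∣ (Empty-unique empty)) (∣⊥∣≡0 k)) ≢0

module _ {k} {A : Subset k} {x} (x∈A : x ∈ A) where

  two-elements⇒2≤∣∣ : ∀ {y} → y ∈ A → y ≢ x → 2 ≤ ∣ A ∣
  two-elements⇒2≤∣∣ y∈A y≢x =
    ≤-trans (s≤s (∈⇒0<∣∣ (x∈p∧x≢y⇒x∈p-y y∈A y≢x))) (x∈p⇒∣p-x∣<∣p∣ x∈A)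

  ∣∣≢1⇒∃-other : ∣ A ∣ ≢ 1 → ∃ λ y → y ∈ A × y ≢ x
  ∣∣≢1⇒∃-other ≢1 with any? (λ y → (y ∈? A) ×-dec ¬? (y ≟ᶠ x))
  ... | yes other = other
  ... | no none = contradiction (trans (cong ∣_∣ A≡⁅x⁆) (∣⁅x⁆∣≡1 x)) ≢1
    where
    A≡⁅x⁆ : A ≡ ⁅ x ⁆
    A≡⁅x⁆ = ⊆-antisym
      (λ {y} y∈A → subst (_∈ ⁅ x ⁆)
        (sym (decidable-stable (y ≟ᶠ x) (λ y≢x → none (y , y∈A , y≢x)))) (x∈⁅x⁆ x))
      (λ y∈ → subst (_∈ A) (sym (x∈⁅y⁆⇒x≡y x y∈)) x∈A)

module _ {m} (τ : Permutation′ m) where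

  ∈-image⁺ : ∀ {ℓ i} → τ ⟨$⟩ˡ i ∈ ℓ → i ∈ image τ ℓ
  ∈-image⁺ {i = i} h = lookup⇒[]= i _ (trans (lookup∘tabulate _ i) ([]=⇒lookup h))

  ∈-image⁻ : ∀ {ℓ i} → i ∈ image τ ℓ → τ ⟨$⟩ˡ i ∈ ℓ
  ∈-image⁻ {ℓ} {i} h = lookup⇒[]= _ ℓ (trans (sym (lookup∘tabulate _ i)) ([]=⇒lookup h))

  image-inverse : ∀ ℓ → image τ (image (flip τ) ℓ) ≡ ℓ
  image-inverse ℓ = trans
    (tabulate-cong λ i → trans (lookup∘tabulate _ (τ ⟨$⟩ˡ i)) (cong (Vec.lookup ℓ) (inverseʳ τ)))
    (tabulate∘lookup ℓ)

-- Paths and valencies in an association scheme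

module SchemeProperties (S : AssociationScheme) where
  open AssociationScheme S

  r-diagonal : ∀ {x} → r x x ≡ 1X
  r-diagonal {x} = Equivalence.from (1X-diagonal x x) refl

  *-flip : ∀ {s x y} → r x y ≡ s → r y x ≡ s *
  *-flip {s} {x} {y} = Equivalence.from (*-converse s y x)

  *-unflip : ∀ {s x y} → r x y ≡ s * → r y x ≡ s
  *-unflip {s} {x} {y} = Equivalence.to (*-converse s x y)

  flip-cong : ∀ {x y x′ y′} → r x y ≡ r x′ y′ → r y x ≡ r y′ x′
  flip-cong eq = trans (*-flip eq) (sym (*-flip refl))

  ∈⟶⁺ : ∀ {x y s} → r x y ≡ s → y ∈ x ⟶ s
  ∈⟶⁺ {x} {s = s} = ∈⟦⟧⁺ (λ y → r x y ≟ᶠ s)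

  ∈⟶⁻ : ∀ {x y s} → y ∈ x ⟶ s → r x y ≡ s
  ∈⟶⁻ {x} {s = s} = ∈⟦⟧⁻ (λ y → r x y ≟ᶠ s)

  c≢0⁺ : ∀ {s t x y z} → r x z ≡ s → r z y ≡ t → c s t (r x y) ≢ 0
  c≢0⁺ {s} {t} {x} {y} xz zy c≡0 = n≮0 (≤-trans
    (∈⇒0<∣∣ (x∈p∩q⁺ (∈⟶⁺ xz , ∈⟶⁺ (*-flip zy))))
    (≤-reflexive (trans (c-regular s t _ x y refl) c≡0)))

  c≢0⁻ : ∀ {s t x y} → c s t (r x y) ≢ 0 → ∃ λ z → r x z ≡ s × r z y ≡ t
  c≢0⁻ {s} {t} {x} {y} c≢0
    with z , z∈ ← ∣∣≢0⇒∃∈ (c≢0 ∘ trans (sym (c-regular s t _ x y refl)))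
    with xz , yz ← x∈p∩q⁻ _ _ z∈ = z , ∈⟶⁻ xz , *-unflip (∈⟶⁻ yz)

  module _ {P Q : Subset d} where

    ·⁺ : ∀ {x y z} → r x z ∈ P → r z y ∈ Q → r x y ∈ P · Q
    ·⁺ {x} {y} {z} p q = ∈⟦⟧⁺
      (λ s → any? λ p → any? λ q → (p ∈? P) ×-dec (q ∈? Q) ×-dec ¬? (c p q s ≟ⁿ 0))
      (r x z , r z y , p , q , c≢0⁺ refl refl)

    ·⁻ : ∀ {x y} → r x y ∈ P · Q → ∃ λ z → r x z ∈ P × r z y ∈ Q
    ·⁻ h
      with p , q , p∈ , q∈ , c≢0 ← ∈⟦⟧⁻
        (λ s → any? λ p → any? λ q → (p ∈? P) ×-dec (q ∈? Q) ×-dec ¬? (c p q s ≟ⁿ 0)) h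
      with z , refl , refl ← c≢0⁻ c≢0 = z , p∈ , q∈

  module _ {P : Subset d} where

    ∈⟶⋃⁺ : ∀ {x y} → r x y ∈ P → y ∈ (x ⟶⋃ P)
    ∈⟶⋃⁺ {x} {y} h =
      ∈⟦⟧⁺ (λ y → any? λ s → (s ∈? P) ×-dec (y ∈? (x ⟶ s))) (r x y , h , ∈⟶⁺ refl)

    ∈⟶⋃⁻ : ∀ {x y} → y ∈ (x ⟶⋃ P) → r x y ∈ P
    ∈⟶⋃⁻ {x} h
      with s , s∈ , y∈ ← ∈⟦⟧⁻ (λ y → any? λ s → (s ∈? P) ×-dec (y ∈? (x ⟶ s))) h =
      subst (_∈ P) (sym (∈⟶⁻ y∈)) s∈

  opaque

    -- The number of paths of two given colours from x to y depends only on `r x y`, so a path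
    -- through z can be copied to any pair of the same colour. Most later arguments use regularity
    -- in this form.
    transfer : ∀ {x y x′ y′} → r x y ≡ r x′ y′ →
               ∀ z → ∃ λ z′ → r x′ z′ ≡ r x z × r z′ y′ ≡ r z y
    transfer {x} {y} eq z =
      c≢0⁻ (c≢0⁺ {x = x} {y} {z} refl refl ∘ trans (cong (c (r x z) (r z y)) eq))

    successor : ∀ s x → ∃ λ y → r x y ≡ s
    successor s x
      with a , b , refl ← r-nonempty s
      -- All diagonal pairs have colour `1X`, so the closed path from a through b is copied to one
      -- at x.
      with y , eq , _ ← transfer {a} {a} {x} {x} (trans r-diagonal (sym r-diagonal)) b = y , eq

    predecessor : ∀ s y → ∃ λ x → r x y ≡ s
    predecessor s y with x , eq ← successor (s *) y = x , *-unflip eq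

  private
    -- The set counted by the valency of s is the set of s-neighbours of x, since s** = s.
    ∈-star : ∀ {s x y} → r x y ≡ s → y ∈ (x ⟶ s) ∩ (x ⟶ (s * *))
    ∈-star eq = x∈p∩q⁺ (∈⟶⁺ eq , ∈⟶⁺ (*-flip (*-flip eq)))

    ∣star∣ : ∀ s x → ∣ (x ⟶ s) ∩ (x ⟶ (s * *)) ∣ ≡ valency s
    ∣star∣ s x = c-regular s (s *) 1X x x r-diagonal

  opaque

    thin-unique : ∀ {x y y′} → r x y ∈ thinRadical → r x y ≡ r x y′ → y ≡ y′
    thin-unique {x} {y} {y′} thin eq = decidable-stable (y ≟ᶠ y′) λ y≢y′ →
      <-irrefl (sym (trans (∣star∣ _ x) (∈⟦⟧⁻ (λ s → valency s ≟ⁿ 1) thin)))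
        (two-elements⇒2≤∣∣ (∈-star (sym eq)) (∈-star refl) y≢y′)

    nonthin-other : ∀ {x y} → ¬ (r x y ∈ thinRadical) → ∃ λ y′ → r x y′ ≡ r x y × y′ ≢ y
    nonthin-other {x} {y} ∉T =
      let y′ , y′∈ , y′≢y = ∣∣≢1⇒∃-other (∈-star {x = x} {y} refl)
            (∉T ∘ ∈⟦⟧⁺ (λ s → valency s ≟ⁿ 1) ∘ trans (sym (∣star∣ _ x)))
      in y′ , ∈⟶⁻ (proj₁ (x∈p∩q⁻ _ _ y′∈)) , y′≢y

-- The group T acting within its cosets

-- T is a variable, and several definitions are opaque, because normalising
-- thinRadical and complex products is prohibitively expensive.
module ThinResidue {p : ℕ} (p-prime : Prime p) (S : AssociationScheme)
  (T : Subset (AssociationScheme.d S))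
  (T≡thinRadical : T ≡ AssociationScheme.thinRadical S)
  (T≐thinResidue : (_∈ T) ≐ AssociationScheme.thinResidue S)
  (iso : IsomorphicToCp×Cp S p T) where

  open AssociationScheme S
  open SchemeProperties S hiding (thin-unique; nonthin-other)
  open Plane p-prime
  open IsomorphicToCp×Cp iso using (φ; homo) renaming (image to φ-image)

  opaque

    thin-unique : ∀ {x y y′} → r x y ∈ T → r x y ≡ r x y′ → y ≡ y′
    thin-unique = SchemeProperties.thin-unique S ∘ subst (_ ∈_) T≡thinRadical

    nonthin-other : ∀ {x y} → ¬ (r x y ∈ T) → ∃ λ y′ → r x y′ ≡ r x y × y′ ≢ y
    nonthin-other ∉T =
      SchemeProperties.nonthin-other S (∉T ∘ subst (_ ∈_) (sym T≡thinRadical))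

  φ∈T : ∀ {a s} → s ≡ φ a → s ∈ T
  φ∈T eq = proj₂ φ-image (_ , sym eq)

  ∈T⇒φ : ∀ {s} → s ∈ T → ∃ λ a → φ a ≡ s
  ∈T⇒φ = proj₁ φ-image

  φ-⊕ : ∀ {a₁ a₂ b₁ b₂ x y z} → r x y ≡ φ (a₁ , a₂) → r y z ≡ φ (b₁ , b₂) →
        r x z ≡ φ (a₁ ⊕ b₁ , a₂ ⊕ b₂)
  φ-⊕ xy yz = proj₂ (homo _ _ _ _) (_ , xy , yz)

  -- The colour e = `φ origin` satisfies ee = e. Splitting a pair (x , y) of colour e at w, thinness
  -- forces w = y, so `r y y` has colour e.
  φ-origin : φ origin ≡ 1X
  φ-origin
    with x , y , eq ← r-nonempty (φ origin)
    with w , xw , wy ← proj₁ (homo _ _ _ _)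
           (trans eq (cong φ (sym (cong₂ _,_ ([]-⊕ 0 0) ([]-⊕ 0 0)))))
    with refl ← thin-unique (φ∈T xw) (trans xw (sym eq)) = trans (sym wy) r-diagonal

  infix 4 _~_
  _~_ : Fin n → Fin n → Set
  x ~ y = r x y ∈ T

  opaque

    ~-refl : ∀ {x} → x ~ x
    ~-refl = φ∈T (trans r-diagonal (sym φ-origin))

    ~-sym : ∀ {x y} → x ~ y → y ~ x
    ~-sym {x} {y} x~y
      with (a₁ , a₂) , xy ← ∈T⇒φ x~y
      with b₁ , ab₁ ← ⊕-inverse a₁ | b₂ , ab₂ ← ⊕-inverse a₂
      with z , yz ← successor (φ (b₁ , b₂)) y
      with refl ← Equivalence.to (1X-diagonal x z)
             (trans (φ-⊕ (sym xy) yz) (trans (cong φ (cong₂ _,_ ab₁ ab₂)) φ-origin)) = φ∈T yz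

    ~-trans : ∀ {x y z} → x ~ y → y ~ z → x ~ z
    ~-trans x~y y~z with _ , xy ← ∈T⇒φ x~y | _ , yz ← ∈T⇒φ y~z = φ∈T (φ-⊕ (sym xy) (sym yz))

    T-comm : ∀ {x y z} → x ~ y → y ~ z → ∃ λ y′ → r x y′ ≡ r y z × r y′ z ≡ r x y
    T-comm x~y y~z
      with (a₁ , a₂) , xy ← ∈T⇒φ x~y | (b₁ , b₂) , yz ← ∈T⇒φ y~z
      with y′ , xy′ , y′z ← proj₁ (homo b₁ b₂ a₁ a₂)
             (trans (φ-⊕ (sym xy) (sym yz)) (cong φ (cong₂ _,_ (⊕-comm a₁ b₁) (⊕-comm a₂ b₂)))) =
      y′ , trans xy′ yz , trans y′z xy

    -- The path x′, x, y, y′ has its first colour converse to its last and its middle one in T, so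
    -- `r x′ y′` lies in s* U s for every strongly normal U, hence in the thin residue.
    T-normal : ∀ {x y x′ y′} → x ~ y → r x x′ ≡ r y y′ → x′ ~ y′
    T-normal {x} {y} {x′} {y′} x~y eq = proj₂ T≐thinResidue λ U U-normal →
      IsStronglyNormal.normal U-normal (r y y′)
        (·⁺ (·⁺ (subst (_∈ ⁅ r y y′ * ⁆) (sym (*-flip eq)) (x∈⁅x⁆ _))
                (proj₁ T≐thinResidue x~y U U-normal))
            (x∈⁅x⁆ _))

  -- The subgroups L(s)

  private
    L? : ∀ s → Decidable (λ t → t ∈ T × ⁅ t ⁆ · ⁅ s ⁆ ≡ ⁅ s ⁆)
    L? s t = (t ∈? T) ×-dec ((⁅ t ⁆ · ⁅ s ⁆) ≟ˢ ⁅ s ⁆)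

  opaque

    𝐋 : Fin d → Subset d
    𝐋 = L S T

    L⊆T : ∀ s → 𝐋 s ⊆ T
    L⊆T s = proj₁ ∘ ∈⟦⟧⁻ (L? s)

    L-absorbs : ∀ {x x′ y} → r x′ x ∈ 𝐋 (r x y) → r x′ y ≡ r x y
    L-absorbs {x} {x′} {y} h = x∈⁅y⁆⇒x≡y _
      (subst (r x′ y ∈_) (proj₂ (∈⟦⟧⁻ (L? _) h)) (·⁺ (x∈⁅x⁆ (r x′ x)) (x∈⁅x⁆ (r x y))))

  -- Copy the path from x to y through x′ to the pair (w , b); thinness identifies the new
  -- intermediate point with a.
  thin-absorbs : ∀ {x x′ y a b w} → x′ ~ x → r x′ y ≡ r x y →
                 r a w ≡ r x′ x → r w b ≡ r x y → r a b ≡ r x y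
  thin-absorbs {x′ = x′} x′~x eq aw wb
    with w′ , ww′ , w′b ← transfer (sym wb) x′
    with refl ← thin-unique (subst (_∈ T) (sym ww′) (~-sym x′~x))
           (trans ww′ (sym (flip-cong aw))) = trans w′b eq

  opaque
    unfolding 𝐋

    -- Together with `L-absorbs` this gives L(s) = s s*. One pair of points suffices, because the
    -- product of a thin colour with s is a single colour.
    ∈L⁺ : ∀ {x x′ y} → r x′ y ≡ r x y → r x′ x ∈ 𝐋 (r x y)
    ∈L⁺ {x} {x′} {y} eq = ∈⟦⟧⁺ (L? s) (x′~x , ⊆-antisym absorbed absorbs)
      where
      t s : Fin d
      t = r x′ x
      s = r x y
      x′~x : x′ ~ x
      x′~x = T-normal ~-refl (flip-cong eq)
      absorbs : ⁅ s ⁆ ⊆ ⁅ t ⁆ · ⁅ s ⁆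
      absorbs u∈ = subst (_∈ ⁅ t ⁆ · ⁅ s ⁆) (trans eq (sym (x∈⁅y⁆⇒x≡y s u∈)))
        (·⁺ {⁅ t ⁆} {⁅ s ⁆} (x∈⁅x⁆ t) (x∈⁅x⁆ s))
      absorbed : ⁅ t ⁆ · ⁅ s ⁆ ⊆ ⁅ s ⁆
      absorbed {u} u∈ =
        let a , b , ab = r-nonempty u
            w , aw , wb = ·⁻ {⁅ t ⁆} {⁅ s ⁆} (subst (_∈ ⁅ t ⁆ · ⁅ s ⁆) (sym ab) u∈)
        in subst (_∈ ⁅ s ⁆)
             (trans (sym (thin-absorbs x′~x eq (x∈⁅y⁆⇒x≡y t aw) (x∈⁅y⁆⇒x≡y s wb))) ab)
             (x∈⁅x⁆ s)

  -- Absorption gives `r x′ y ≡ r x y`. Copying the path from x to y through z moves z to a point in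
  -- the same thin relation to y, which is z itself.
  L-right : ∀ {x y z} → y ~ z → 𝐋 (r x y) ⊆ 𝐋 (r x z)
  L-right {x} {y} {z} y~z {t} t∈
    with x′ , refl ← predecessor t x
    with z′ , x′z′ , z′y ← transfer (sym (L-absorbs t∈)) z
    with refl ← thin-unique y~z (sym (flip-cong z′y)) = ∈L⁺ x′z′

  -- Commutativity of T completes the parallelogram: a t-step from w′ to w becomes a t-step from x′
  -- to x, to which absorption applies.
  L-left : ∀ {w x y} → w ~ x → 𝐋 (r x y) ⊆ 𝐋 (r w y)
  L-left {w} {x} {y} w~x {t} t∈
    with w′ , refl ← predecessor t w
    with x′ , w′x′ , x′x ← T-comm (L⊆T _ t∈) w~x
    with w″ , x′w″ , w″y ←
           transfer (sym (L-absorbs (subst (_∈ 𝐋 (r x y)) (sym x′x) t∈))) w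
    with refl ← thin-unique (subst (_∈ T) (sym x′w″) (~-sym w~x))
           (trans x′w″ (sym (flip-cong w′x′))) = ∈L⁺ w″y

  L-cong : ∀ {x y x′ y′} → x ~ x′ → y ~ y′ → 𝐋 (r x y) ≡ 𝐋 (r x′ y′)
  L-cong x~x′ y~y′ = ⊆-antisym
    (L-left (~-sym x~x′) ∘ L-right y~y′) (L-left x~x′ ∘ L-right (~-sym y~y′))

  L-submonoid : ∀ s → IsSubmonoid (λ a → φ a ∈ 𝐋 s)
  L-submonoid s with x , y , refl ← r-nonempty s = record
    { origin∈  = subst (_∈ 𝐋 s) (trans r-diagonal (sym φ-origin)) (∈L⁺ {x} {x} {y} refl)
    ; ⊕-closed = λ {a₁} {a₂} {b₁} {b₂} a∈ b∈ →
        let x₁ , x₁x  = predecessor (φ (b₁ , b₂)) x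
            x₂ , x₂x₁ = predecessor (φ (a₁ , a₂)) x₁
            x₁y = L-absorbs (subst (_∈ 𝐋 s) (sym x₁x) b∈)
            x₂y = L-absorbs (subst₂ (λ t u → t ∈ 𝐋 u) (sym x₂x₁) (sym x₁y) a∈)
        in subst (_∈ 𝐋 s) (φ-⊕ x₂x₁ x₁x) (∈L⁺ (trans x₂y x₁y))
    }

  Proper : Subset d → Set
  Proper M = ¬ (T ⊆ M)

  L-determined : ∀ {s s′} → Proper (𝐋 s) → ∀ e →
                 φ (direction e) ∈ 𝐋 s → φ (direction e) ∈ 𝐋 s′ → 𝐋 s ⊆ 𝐋 s′
  L-determined {s} {s′} proper e h h′ t∈ with a , refl ← ∈T⇒φ (L⊆T s t∈) =
    determined-by-direction (L-submonoid s) (L-submonoid s′)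
      (λ all → proper λ u∈ → subst (_∈ 𝐋 s) (proj₂ (∈T⇒φ u∈)) (all _)) e h h′ t∈

  -- As T contains every thin colour, `r y x` is not thin; a second point x′ in this relation to y
  -- yields a nontrivial element `r x′ x` of s s*.
  L-direction : ∀ {x y} → ¬ x ~ y → ∃ λ e → φ (direction e) ∈ 𝐋 (r x y)
  L-direction {x} {y} x≁y
    with x′ , yx′ , x′≢x ← nonthin-other (x≁y ∘ ~-sym)
    with x′x∈ ← ∈L⁺ (flip-cong yx′)
    with a , eq ← ∈T⇒φ (L⊆T _ x′x∈) =
    IsSubmonoid.direction∈ (L-submonoid (r x y))
      (λ { refl → x′≢x (Equivalence.to (1X-diagonal x′ x) (trans (sym eq) φ-origin)) })
      (subst (_∈ 𝐋 (r x y)) (sym eq) x′x∈)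

  -- Suppose L(`r y x`) contains T, and let x′ ~ x. Choose y′ with `r x′ y′ ≡ r x y`; by normality
  -- y′ ~ y, so absorption replaces y′ by y, and `r x′ x` lies in L(`r x y`).
  Proper-flip : ∀ {x y} → Proper (𝐋 (r x y)) → Proper (𝐋 (r y x))
  Proper-flip {x} {y} proper T⊆ = proper T⊆′
    where
    T⊆′ : T ⊆ 𝐋 (r x y)
    T⊆′ {t} t∈
      with x′ , refl ← predecessor t x
      with y′ , x′y′ ← successor (r x y) x′
      with yx′ ← L-absorbs (subst (r y y′ ∈_) (cong 𝐋 (sym (flip-cong x′y′)))
                   (T⊆ (~-sym (T-normal t∈ x′y′)))) =
      ∈L⁺ (trans (flip-cong yx′) x′y′)

  -- If r y′ z ≡ r y z, then the path from y to z through x yields x′ with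
  -- r y′ x′ ≡ r y x and r x′ z ≡ r x z; the latter and the hypothesis give
  -- r x′ y ≡ r x y.  So the left-hand side is a nontrivial subgroup of the
  -- right-hand side, which is proper.
  L-triangle : ∀ {x y z} → Proper (𝐋 (r x y)) → 𝐋 (r x y) ≡ 𝐋 (r x z) → ¬ y ~ z →
               𝐋 (r y z) ≡ 𝐋 (r y x)
  L-triangle {x} {y} {z} proper xy≡xz y≁z = ⊆-antisym contained
    (let e , e∈ = L-direction y≁z in L-determined (Proper-flip proper) e (contained e∈) e∈)
    where
    contained : 𝐋 (r y z) ⊆ 𝐋 (r y x)
    contained {t} t∈
      with y′ , refl ← predecessor t y
      with x′ , y′x′ , x′z ← transfer (sym (L-absorbs t∈)) x
      with x′y ← L-absorbs (subst (r x′ x ∈_) (sym xy≡xz) (∈L⁺ x′z)) =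
      subst (λ s → r y′ y ∈ 𝐋 s) (flip-cong x′y) (∈L⁺ (trans y′x′ (sym (flip-cong x′y))))

  -- Cosets and quotient relations

  module Lines {m : ℕ} (E : CosetEnumeration S T m) where

    open CosetEnumeration E

    𝐋ᵢⱼ : Fin m → Fin m → Subset d
    𝐋ᵢⱼ i j = 𝐋 (r (rep i) (rep j))

    line : Fin m → Subset d → Subset m
    line = lineAt S T E

    ~-rep : ∀ {i x} → X i ≡ (x ⟶⋃ T) → x ~ rep i
    ~-rep {i} eq = ∈⟶⋃⁻ (subst (rep i ∈_) (trans (sym (proj₂ (isCoset i))) eq) (∈⟶⋃⁺ ~-refl))

    rep-injective : ∀ {i j} → rep i ~ rep j → i ≡ j
    rep-injective {i} {j} i~j = injective (trans (proj₂ (isCoset i))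
      (trans (⊆-antisym (λ h → ∈⟶⋃⁺ (~-trans (~-sym i~j) (∈⟶⋃⁻ h)))
                        (λ h → ∈⟶⋃⁺ (~-trans i~j (∈⟶⋃⁻ h))))
             (sym (proj₂ (isCoset j)))))

    -- The relation s^T, with the complex product T s T spelled out.
    _⟨_⟩_ : Fin m → Fin d → Fin m → Set
    i ⟨ s ⟩ j = ∃₂ λ x y → rep i ~ x × r x y ≡ s × y ~ rep j

    rep-⟨⟩ : ∀ i j → i ⟨ r (rep i) (rep j) ⟩ j
    rep-⟨⟩ i j = rep i , rep j , ~-refl , refl , ~-refl

    ⟨⟩⇒quotient : ∀ {s i j} → i ⟨ s ⟩ j → quotient s i j
    ⟨⟩⇒quotient {s} {i} {j} (x , y , i~x , xy , y~j) =
      rep i , rep j , proj₂ (isCoset i) , proj₂ (isCoset j) ,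
      ∈⟶⋃⁺ (·⁺ {T · ⁅ s ⁆} {T} (·⁺ {T} {⁅ s ⁆} i~x (subst (_∈ ⁅ s ⁆) (sym xy) (x∈⁅x⁆ s))) y~j)

    quotient⇒⟨⟩ : ∀ {s i j} → quotient s i j → i ⟨ s ⟩ j
    quotient⇒⟨⟩ {s} (x , y , Xi , Xj , h) =
      let v , h′ , v~y = ·⁻ {T · ⁅ s ⁆} {T} (∈⟶⋃⁻ h)
          u , x~u , uv = ·⁻ {T} {⁅ s ⁆} h′
      in u , v , ~-trans (~-sym (~-rep Xi)) x~u , x∈⁅y⁆⇒x≡y s uv , ~-trans v~y (~-rep Xj)

    -- Two quotient relations sharing a pair of cosets coincide. Here a and then b are copied along
    -- the equality of the colours of (a′ , b′) and of the representatives of i′ and j′.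
    ⟨⟩-transfer : ∀ {s i j i′ j′} → i ⟨ s ⟩ j → i ⟨ r (rep i′) (rep j′) ⟩ j → i′ ⟨ s ⟩ j′
    ⟨⟩-transfer (a , b , i~a , ab , b~j) (a′ , b′ , i~a′ , a′b′ , b′~j) =
      let a₀ , i′a₀ , a₀j′ = transfer a′b′ a
          b₀ , a₀b₀ , b₀j′ = transfer (sym a₀j′) b
      in a₀ , b₀ ,
         subst (_∈ T) (sym i′a₀) (~-trans (~-sym i~a′) i~a) ,
         trans a₀b₀ ab ,
         subst (_∈ T) (sym b₀j′) (~-trans b~j (~-sym b′~j))

    -- This is the independence of L_ij from the choice of s.
    L-⟨⟩ : ∀ {s i j} → i ⟨ s ⟩ j → 𝐋ᵢⱼ i j ≡ 𝐋 s
    L-⟨⟩ (x , y , i~x , xy , y~j) = trans (L-cong i~x (~-sym y~j)) (cong 𝐋 xy)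

    -- Lines and their points

    opaque
      unfolding 𝐋

      ∈-line⁺ : ∀ {i j M} → j ≡ i ⊎ 𝐋ᵢⱼ i j ≡ M → j ∈ line i M
      ∈-line⁺ (inj₁ refl) = x∈p∪q⁺ (inj₁ (x∈⁅x⁆ _))
      ∈-line⁺ {i} {j} {M} (inj₂ eq) = x∈p∪q⁺ (inj₂ (∈⟦⟧⁺ (λ j → 𝐋ᵢⱼ i j ≟ˢ M) eq))

      ∈-line⁻ : ∀ {i j M} → j ∈ line i M → j ≡ i ⊎ 𝐋ᵢⱼ i j ≡ M
      ∈-line⁻ {i} {j} {M} h with x∈p∪q⁻ _ _ h
      ... | inj₁ j∈ = inj₁ (x∈⁅y⁆⇒x≡y _ j∈)
      ... | inj₂ j∈ = inj₂ (∈⟦⟧⁻ (λ j → 𝐋ᵢⱼ i j ≟ˢ M) j∈)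

    line-swap-⊆ : ∀ {i j} → Proper (𝐋ᵢⱼ i j) → line i (𝐋ᵢⱼ i j) ⊆ line j (𝐋ᵢⱼ j i)
    line-swap-⊆ {i} {j} proper {k} k∈ with k ≟ᶠ j | ∈-line⁻ k∈
    ... | yes k≡j | _         = ∈-line⁺ (inj₁ k≡j)
    ... | no _    | inj₁ refl = ∈-line⁺ (inj₂ refl)
    ... | no k≢j  | inj₂ eq   =
      ∈-line⁺ (inj₂ (L-triangle proper (sym eq) (k≢j ∘ sym ∘ rep-injective)))

    line-swap : ∀ {i j} → Proper (𝐋ᵢⱼ i j) → line i (𝐋ᵢⱼ i j) ≡ line j (𝐋ᵢⱼ j i)
    line-swap proper = ⊆-antisym (line-swap-⊆ proper) (line-swap-⊆ (Proper-flip proper))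

    -- The resulting form depends only on i and j, which gives uniqueness. If i is not the base
    -- point a, `line-swap` moves the base from a to i.
    line-through : ∀ {ℓ i j} → IsLine S T E ℓ → i ≢ j → i ∈ ℓ → j ∈ ℓ →
                   Proper (𝐋ᵢⱼ i j) × ℓ ≡ line i (𝐋ᵢⱼ i j)
    line-through {i = i} {j} (a , M , _ , _ , (_ , t , t∈T , t∉M) , _ , refl) i≢j i∈ j∈ =
      at (∈-line⁻ i∈)
      where
      M-proper : Proper M
      M-proper T⊆M = t∉M (T⊆M t∈T)
      at : i ≡ a ⊎ 𝐋ᵢⱼ a i ≡ M → Proper (𝐋ᵢⱼ i j) × line a M ≡ line i (𝐋ᵢⱼ i j)
      at (inj₁ refl) with ∈-line⁻ j∈
      ... | inj₁ j≡i  = contradiction (sym j≡i) i≢j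
      ... | inj₂ refl = M-proper , refl
      at (inj₂ refl) with ∈-line⁻ (subst (j ∈_) (line-swap M-proper) j∈)
      ... | inj₁ j≡i = contradiction (sym j≡i) i≢j
      ... | inj₂ eq  = subst Proper (sym eq) (Proper-flip M-proper) ,
                       trans (line-swap M-proper) (cong (line i) (sym eq))

    line-other : ∀ {ℓ i} → IsLine S T E ℓ → i ∈ ℓ → ∃ λ j → j ∈ ℓ × j ≢ i
    line-other (_ , _ , _ , _ , _ , ≢1 , refl) i∈ = ∣∣≢1⇒∃-other i∈ ≢1

    isPartialLinearSpace : IsPartialLinearSpace (IsLine S T E)
    isPartialLinearSpace = record
      { unique-line = λ i≢j ℓ-line ℓ′-line i∈ j∈ i∈′ j∈′ →
          trans (proj₂ (line-through ℓ-line i≢j i∈ j∈))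
                (sym (proj₂ (line-through ℓ′-line i≢j i∈′ j∈′)))
      ; two-points  = two-points
      }
      where
      two-points : ∀ {ℓ} → IsLine S T E ℓ → 2 ≤ ∣ ℓ ∣
      two-points ℓ-line@(a , _ , _ , _ , _ , _ , refl)
        with a∈ ← ∈-line⁺ (inj₁ refl)
        with j , j∈ , j≢a ← line-other ℓ-line a∈ = two-elements⇒2≤∣∣ a∈ j∈ j≢a

    -- A line through i is labelled by the direction of the subgroup 𝐋ᵢⱼ i j
    -- of order p, where j is any other point of the line.
    lines-at-point : ∀ i → AtMost (p + 1) (λ ℓ → IsLine S T E ℓ × i ∈ ℓ)
    lines-at-point i = atMost-by-labels Label label label-injective
      where
      Label : Subset m → Fin (p + 1) → Set
      Label ℓ e = ∃ λ j → j ∈ ℓ × j ≢ i × φ (direction (splitAt p e)) ∈ 𝐋ᵢⱼ i j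

      label : ∀ {ℓ} → IsLine S T E ℓ × i ∈ ℓ → ∃ (Label ℓ)
      label (ℓ-line , i∈)
        with j , j∈ , j≢i ← line-other ℓ-line i∈
        with e , e∈ ← L-direction (λ i~j → j≢i (sym (rep-injective i~j))) =
        join p 1 e , j , j∈ , j≢i ,
        subst (λ e → φ (direction e) ∈ 𝐋ᵢⱼ i j) (sym (splitAt-join p 1 e)) e∈

      label-injective : ∀ {ℓ ℓ′ e} → IsLine S T E ℓ × i ∈ ℓ → IsLine S T E ℓ′ × i ∈ ℓ′ →
                        Label ℓ e → Label ℓ′ e → ℓ ≡ ℓ′
      label-injective {e = e} (ℓ-line , i∈) (ℓ′-line , i∈′)
                      (j , j∈ , j≢i , e∈) (j′ , j′∈ , j′≢i , e∈′)
        with proper , refl ← line-through ℓ-line (j≢i ∘ sym) i∈ j∈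
           | proper′ , refl ← line-through ℓ′-line (j′≢i ∘ sym) i∈′ j′∈ =
        -- Both subgroups are proper and contain the same direction, so they are equal.
        cong (line i) (⊆-antisym (L-determined proper (splitAt p e) e∈ e∈′)
                                 (L-determined proper′ (splitAt p e) e∈′ e∈))

    -- Automorphisms of the quotient scheme

    Aut : Pred (Permutation′ m) 0ℓ
    Aut = SchemeAut quotient

    Lᵢⱼ-invariant : ∀ τ → Aut τ → ∀ i j → 𝐋ᵢⱼ (τ ⟨$⟩ʳ i) (τ ⟨$⟩ʳ j) ≡ 𝐋ᵢⱼ i j
    Lᵢⱼ-invariant τ aut i j = L-⟨⟩ (quotient⇒⟨⟩ (aut _ (⟨⟩⇒quotient (rep-⟨⟩ i j))))

    -- τ maps (i′ , j′) to (i , j) and preserves the quotient relation of (i′ , j′). So (i , j) lies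
    -- in that relation as well as in s^T, and `⟨⟩-transfer` puts (i′ , j′) into s^T.
    Aut-⁻¹ : ∀ τ → Aut τ → Aut (flip τ)
    Aut-⁻¹ τ aut s {i} {j} q = ⟨⟩⇒quotient (⟨⟩-transfer (quotient⇒⟨⟩ q)
      (subst₂ (_⟨ r (rep i′) (rep j′) ⟩_) (inverseʳ τ) (inverseʳ τ)
        (quotient⇒⟨⟩ (aut _ (⟨⟩⇒quotient (rep-⟨⟩ i′ j′))))))
      where
      i′ j′ : Fin m
      i′ = τ ⟨$⟩ˡ i
      j′ = τ ⟨$⟩ˡ j

    image-line : ∀ τ → Aut τ → ∀ i M → image τ (line i M) ≡ line (τ ⟨$⟩ʳ i) M
    image-line τ aut i M = ⊆-antisym forward backward
      where
      Lᵢⱼ-invariant′ : ∀ k → 𝐋ᵢⱼ (τ ⟨$⟩ʳ i) k ≡ 𝐋ᵢⱼ i (τ ⟨$⟩ˡ k)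
      Lᵢⱼ-invariant′ k = trans (cong (𝐋ᵢⱼ _) (sym (inverseʳ τ))) (Lᵢⱼ-invariant τ aut i _)
      forward : image τ (line i M) ⊆ line (τ ⟨$⟩ʳ i) M
      forward {k} k∈ with ∈-line⁻ (∈-image⁻ τ k∈)
      ... | inj₁ eq = ∈-line⁺ (inj₁ (trans (sym (inverseʳ τ)) (cong (τ ⟨$⟩ʳ_) eq)))
      ... | inj₂ eq = ∈-line⁺ (inj₂ (trans (Lᵢⱼ-invariant′ k) eq))
      backward : line (τ ⟨$⟩ʳ i) M ⊆ image τ (line i M)
      backward {k} k∈ with ∈-line⁻ k∈
      ... | inj₁ eq = ∈-image⁺ τ (∈-line⁺ (inj₁ (trans (cong (τ ⟨$⟩ˡ_) eq) (inverseˡ τ))))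
      ... | inj₂ eq = ∈-image⁺ τ (∈-line⁺ (inj₂ (trans (sym (Lᵢⱼ-invariant′ k)) eq)))

    image-isLine : ∀ τ → Aut τ → ∀ {ℓ} → IsLine S T E ℓ → IsLine S T E (image τ ℓ)
    image-isLine τ aut ℓ-line@(i , M , M-subgroup , 1⊂M , M⊂T , _ , refl) =
      τ ⟨$⟩ʳ i , M , M-subgroup , 1⊂M , M⊂T , ≢1 , image-line τ aut i M
      where
      i∈ : i ∈ line i M
      i∈ = ∈-line⁺ (inj₁ refl)
      moved : ∀ {k} → k ∈ line i M → τ ⟨$⟩ʳ k ∈ line (τ ⟨$⟩ʳ i) M
      moved k∈ = subst (_ ∈_) (image-line τ aut i M)
        (∈-image⁺ τ (subst (_∈ line i M) (sym (inverseˡ τ)) k∈))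
      ≢1 : ∣ line (τ ⟨$⟩ʳ i) M ∣ ≢ 1
      ≢1 ≡1 with j , j∈ , j≢i ← line-other ℓ-line i∈ =
        <-irrefl (sym ≡1) (two-elements⇒2≤∣∣ (moved i∈) (moved j∈)
          λ eq → j≢i (trans (sym (inverseˡ τ)) (trans (cong (τ ⟨$⟩ˡ_) eq) (inverseˡ τ))))

    Aut-isSubgroupOf : Aut IsSubgroupOf IncidenceAut (IsLine S T E)
    Aut-isSubgroupOf = record
      { included  = λ {τ} aut →
          (λ { (ℓ′ , ℓ′-line , refl) → image-isLine τ aut ℓ′-line }) ,
          -- Every line is the image of its preimage, which is a line because the inverse of τ is an
          -- automorphism too.
          (λ {ℓ} ℓ-line → image (flip τ) ℓ , image-isLine (flip τ) (Aut-⁻¹ τ aut) ℓ-line ,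
                          image-inverse τ ℓ)
      ; id∈       = λ _ q → q
      ; ∘-closed  = λ aut aut′ s q → aut′ s (aut s q)
      ; ⁻¹-closed = λ {τ} → Aut-⁻¹ τ
      }

theorem2p7 : (p : ℕ) → Prime p → (S : AssociationScheme) →
    let T = AssociationScheme.thinRadical S in
    (_∈ T) ≐ AssociationScheme.thinResidue S →
    IsomorphicToCp×Cp S p T →
    (m : ℕ) (E : CosetEnumeration S T m) →
    IsPartialLinearSpace (IsLine S T E)
    × (∀ i → AtMost (p + 1) (λ ℓ → IsLine S T E ℓ × i ∈ ℓ))
    × SchemeAut (CosetEnumeration.quotient E) IsSubgroupOf IncidenceAut (IsLine S T E)
theorem2p7 p p-prime S radical≐residue iso m E =
  isPartialLinearSpace , lines-at-point , Aut-isSubgroupOf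
  where
  open ThinResidue.Lines p-prime S _ refl radical≐residue iso E
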